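{- Let $\mathcal H=(V,E)$ be a hypergraph with splitting functions and let $R\subseteq V$ satisfy $0<\mathrm{vol}(R)\le\mathrm{vol}(\bar R)$. Let $\varepsilon_0=\mathrm{vol}(R)/\mathrm{vol}(\bar R)$, let $\varepsilon\in[\varepsilon_0,\varepsilon_0+1)$, and set $\mu=\varepsilon-\varepsilon_0\ge0$. Let $S^*$ be a minimizer of $\mathrm{HLC}$ over all subsets of $V$; this is the set returned by Algorithm 1. Then: 1. For every $T\subseteq R$ with $\mathrm{vol}(T)>0$, we have $\mathrm{cond}(S^*)\le\mathrm{cond}(T)$. 2. Let $T\subseteq V$ satisfy $0<\mathrm{vol}(T)\le\mathrm{vol}(\bar T)$, and suppose that for some $\gamma\in(\mu,1)$, $$\frac{\mathrm{vol}(T\cap R)}{\mathrm{vol}(T)}\ge\frac{\mathrm{vol}(R)}{\mathrm{vol}(V)}+\gamma\,\frac{\mathrm{vol}(\bar R)}{\mathrm{vol}(V)}.$$ Then $\mathrm{cond}(S^*)\le\frac{1}{\gamma-\mu}\mathrm{cond}(T)$. In particular, when $\varepsilon=\varepsilon_0$ we get $\mathrm{cond}(S^*)\le\frac1\gamma\mathrm{cond}(T)$.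
   Context: A hypergraph $\mathcal H=(V,E)$ has a finite node set $V$, and each hyperedge $e\in E$ is a subset of $V$. Each hyperedge $e$ carries a splitting function $w_e:2^e\to\mathbb R_{\ge0}$ satisfying $w_e(A)=w_e(e\setminus A)$ for all $A\subseteq e$ and $w_e(\emptyset)=w_e(e)=0$. For $S\subseteq V$, $\mathrm{cut}_{\mathcal H}(S)=\sum_{e\in E}w_e(e\cap S)$. The degree of $v$ is $d_v=\sum_{e\ni v}w_e(\{v\})$, and $\mathrm{vol}(S)=\sum_{v\in S}d_v$. Write $\bar S=V\setminus S$. Hypergraph conductance is $\mathrm{cond}(S)=\mathrm{cut}_{\mathcal H}(S)/\min\{\mathrm{vol}(S),\mathrm{vol}(\bar S)\}$. Define $\Omega_{R,\varepsilon}(S)=\mathrm{vol}(S\cap R)-\varepsilon\,\mathrm{vol}(S\cap\bar R)$. Set $\mathrm{HLC}(S)=\mathrm{cut}_{\mathcal H}(S)/\Omega_{R,\varepsilon}(S)$ if $\Omega_{R,\varepsilon}(S)>0$, and $\mathrm{HLC}(S)=\infty$ otherwise. -}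

module Defs where

open import Level using (suc; _⊔_)
open import Algebra.Bundles using (CommutativeRing)
open import Algebra.Structures using (IsCommutativeRing)
import Algebra.Construct.NaturalChoice.Min as Min
import Algebra.Properties.CommutativeMonoid.Sum as Sum
open import Data.Bool.Base using (if_then_else_)
open import Data.Fin.Base using (Fin)
open import Data.Fin.Subset using (Subset; _⊆_; _∩_; _─_; ∁; ⁅_⁆; ⊥)
open import Data.Fin.Subset.Properties using (_∈?_)
open import Data.Nat.Base using (ℕ)
open import Function.Definitions using (Injective)
open import Relation.Binary.Bundles using (DecTotalOrder)
open import Relation.Binary.Core using (Rel)
open import Relation.Binary.Structures using (IsDecTotalOrder)
open import Relation.Binary.PropositionalEquality.Core using (_≡_)
import Relation.Binary.Construct.Add.Supremum.NonStrict as AddSupremum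
import Relation.Binary.Properties.DecTotalOrder as DecTotalOrderProperties
import Relation.Binary.Construct.NonStrictToStrict as ToStrict
open import Relation.Binary.Definitions using (Decidable)
open import Relation.Nullary.Decidable.Core using (does)
open import Relation.Nullary.Construct.Add.Supremum using (_⁺; [_]; ⊤⁺)
open import Relation.Nullary.Negation.Core using (¬_)

-- Stands in for ℝ, which the library does not have; classically ℝ is an instance.
record OrderedField c ℓ₁ ℓ₂ : Set (suc (c ⊔ ℓ₁ ⊔ ℓ₂)) where
  infix  8 -_
  infixl 7 _*_ _/_
  infixl 6 _+_ _-_
  infix  4 _≈_ _≤_
  field
    Carrier           : Set c
    _≈_               : Rel Carrier ℓ₁
    _≤_               : Rel Carrier ℓ₂
    _+_               : Carrier → Carrier → Carrier
    _*_               : Carrier → Carrier → Carrier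
    -_                : Carrier → Carrier
    _⁻¹               : Carrier → Carrier
    0#                : Carrier
    1#                : Carrier
    isCommutativeRing : IsCommutativeRing _≈_ _+_ _*_ -_ 0# 1#
    isDecTotalOrder   : IsDecTotalOrder _≈_ _≤_
    0≉1               : ¬ (0# ≈ 1#)
    -- The value of 0# ⁻¹ is left unspecified.
    ⁻¹-cong           : ∀ {x y} → x ≈ y → x ⁻¹ ≈ y ⁻¹
    ⁻¹-inverseʳ       : ∀ x → ¬ (x ≈ 0#) → x * x ⁻¹ ≈ 1#
    +-monoʳ-≤         : ∀ x {y z} → y ≤ z → x + y ≤ x + z
    *-nonNegative     : ∀ {x y} → 0# ≤ x → 0# ≤ y → 0# ≤ x * y

  commutativeRing : CommutativeRing c ℓ₁
  commutativeRing = record { isCommutativeRing = isCommutativeRing }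

  decTotalOrder : DecTotalOrder c ℓ₁ ℓ₂
  decTotalOrder = record { isDecTotalOrder = isDecTotalOrder }

  open DecTotalOrder decTotalOrder using (_≟_; _≤?_; totalOrder)
  open DecTotalOrderProperties decTotalOrder public using (_<_)
  open Min totalOrder public using (_⊓_)
  open Sum (CommutativeRing.+-commutativeMonoid commutativeRing) public using (sum)

  infix 4 _<?_
  _<?_ : Decidable _<_
  _<?_ = ToStrict.<-decidable _≈_ _≤_ _≟_ _≤?_

  _-_ : Carrier → Carrier → Carrier
  x - y = x + (- y)

  _/_ : Carrier → Carrier → Carrier
  x / y = x * y ⁻¹

  open AddSupremum _≤_ public using (_≤⁺_)

  infixl 7 _/⁺_ _*⁺_

  -- Quotient valued in the field extended by ∞ (⊤⁺), finite exactly when the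
  -- denominator is positive; in particular 0 /⁺ 0 is ∞.
  _/⁺_ : Carrier → Carrier → Carrier ⁺
  x /⁺ y = if does (0# <? y) then [ x / y ] else ⊤⁺

  -- Only meaningful for a positive scalar.
  _*⁺_ : Carrier → Carrier ⁺ → Carrier ⁺
  a *⁺ [ x ] = [ a * x ]
  a *⁺ ⊤⁺    = ⊤⁺

module _ {c ℓ₁ ℓ₂} (F : OrderedField c ℓ₁ ℓ₂) where
  open OrderedField F

  -- The domain of the splitting function of e is the power set of e: w e is
  -- constrained, and used below, only at subsets of edge e.
  record Hypergraph : Set (c ⊔ ℓ₁ ⊔ ℓ₂) where
    field
      ∣V∣            : ℕ
      ∣E∣            : ℕ
      edge           : Fin ∣E∣ → Subset ∣V∣
      edge-injective : Injective _≡_ _≡_ edge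
      w              : Fin ∣E∣ → Subset ∣V∣ → Carrier
      w-nonNegative  : ∀ e A → A ⊆ edge e → 0# ≤ w e A
      w-symmetric    : ∀ e A → A ⊆ edge e → w e A ≈ w e (edge e ─ A)
      w-empty        : ∀ e → w e ⊥ ≈ 0#
      w-full         : ∀ e → w e (edge e) ≈ 0#

module _ {c ℓ₁ ℓ₂} {F : OrderedField c ℓ₁ ℓ₂} (H : Hypergraph F) where
  open OrderedField F
  open Hypergraph H

  cut : Subset ∣V∣ → Carrier
  cut S = sum λ e → w e (edge e ∩ S)

  degree : Fin ∣V∣ → Carrier
  degree v = sum λ e → if does (v ∈? edge e) then w e ⁅ v ⁆ else 0#

  vol : Subset ∣V∣ → Carrier
  vol S = sum λ v → if does (v ∈? S) then degree v else 0#

  -- Equal to ∞ where the denominator vanishes, so that an upper bound on cond S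
  -- by a finite quantity includes the claim that the quotient is defined.
  cond : Subset ∣V∣ → Carrier ⁺
  cond S = cut S /⁺ (vol S ⊓ vol (∁ S))

  Ω : Subset ∣V∣ → Carrier → Subset ∣V∣ → Carrier
  Ω R ε S = vol (S ∩ R) - ε * vol (S ∩ ∁ R)

  HLC : Subset ∣V∣ → Carrier → Subset ∣V∣ → Carrier ⁺
  HLC R ε S = cut S /⁺ Ω R ε S

  IsMinimizerHLC : Subset ∣V∣ → Carrier → Subset ∣V∣ → Set (c ⊔ ℓ₂)
  IsMinimizerHLC R ε S* = ∀ S → HLC R ε S* ≤⁺ HLC R ε S

{-# OPTIONS --safe #-}

-- Write m S for min (vol S) (vol (∁ S)). The choice ε ≥ ε₀ makes Ω S ≤ m S for
-- every S, while a set T that overlaps R well satisfies δ * m T ≤ Ω T for a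
-- suitable δ > 0 (δ = 1 if T ⊆ R). Since quotients are antitone in their
-- denominator, minimality of S* gives
--   cond S* ≤ HLC S* ≤ HLC T ≤ cut T / (δ * m T) = cond T / δ.
module Submission where

open import Defs
open import Level using (Level)
open import Algebra.Bundles using (CommutativeRing)
import Algebra.Construct.NaturalChoice.Min as Min
import Algebra.Construct.NaturalChoice.MinOp as MinOp
import Algebra.Properties.CommutativeMonoid.Sum as Sum
import Algebra.Properties.Ring as RingProperties
import Algebra.Solver.Ring.NaturalCoefficients.Default as SemiringSolver
open import Data.Bool.Base using (if_then_else_)
open import Data.Fin.Base using (Fin; zero; suc)
open import Data.Fin.Subset using (Subset; _⊆_; _∩_; ∁; ⊤; ⊥; Empty; inside; outside; _∈_; ⁅_⁆)
open import Data.Fin.Subset.Properties using (_∈?_; ∉⊥; x∈⁅y⁆⇒x≡y; p∩q⊆p; x∈p∩q⁻; x∈∁p⇒x∉p; ∩-comm; ∩-identityˡ; Empty-unique)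
open import Data.Nat.Base using (zero; suc)
open import Data.Product.Base using (_×_; _,_)
open import Data.Sum.Base using (inj₁; inj₂)
open import Data.Vec.Base using (_∷_)
open import Data.Vec.Functional using (Vector; tail)
open import Function.Base using (_∘_)
open import Relation.Binary.Bundles using (DecTotalOrder)
import Relation.Binary.Construct.Add.Supremum.NonStrict as AddSupremum
open import Relation.Binary.PropositionalEquality.Core using (_≡_; subst; subst₂; cong) renaming (sym to ≡-sym)
import Relation.Binary.Reasoning.PartialOrder as PartialOrderReasoning
open import Relation.Nullary.Construct.Add.Supremum using ([_]; ⊤⁺)
open import Relation.Nullary.Decidable using (does; yes; no; dec-true; dec-false)
open import Relation.Nullary.Negation.Core using (¬_; contradiction)

-- Inequalities and quotients in an ordered field.

module OrderedFieldProperties {c ℓ₁ ℓ₂} (F : OrderedField c ℓ₁ ℓ₂) where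
  open OrderedField F
  open CommutativeRing commutativeRing public
    using (ring; commutativeSemiring; refl; sym; trans; reflexive; +-cong; +-congˡ; +-congʳ; *-cong; *-congˡ; *-congʳ; +-comm; +-assoc; *-comm; *-assoc; +-identityˡ; +-identityʳ; *-identityˡ; *-identityʳ; zeroˡ; zeroʳ; -‿inverseˡ; -‿inverseʳ)
  open DecTotalOrder decTotalOrder public
    using (totalOrder; poset; total; ≤-respˡ-≈; ≤-respʳ-≈) renaming (refl to ≤-refl; reflexive to ≤-reflexive; trans to ≤-trans; antisym to ≤-antisym)
  open MinOp (Min.minOperator totalOrder) public using (x⊓y≤x; ⊓-glb)
  open RingProperties ring using (-‿distribʳ-*; -‿distribˡ-*; -‿involutive)
  open PartialOrderReasoning poset
  open SemiringSolver commutativeSemiring using (solve; _:=_; _:+_; _:*_)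

  +-monoˡ-≤ : ∀ x {y z} → y ≤ z → y + x ≤ z + x
  +-monoˡ-≤ x {y} {z} y≤z = begin
    y + x  ≈⟨ +-comm y x ⟩
    x + y  ≤⟨ +-monoʳ-≤ x y≤z ⟩
    x + z  ≈⟨ +-comm x z ⟩
    z + x  ∎

  +-mono-≤ : ∀ {x y u v} → x ≤ y → u ≤ v → x + u ≤ y + v
  +-mono-≤ {y = y} {u} x≤y u≤v = ≤-trans (+-monoˡ-≤ u x≤y) (+-monoʳ-≤ y u≤v)

  x≤x+y : ∀ x {y} → 0# ≤ y → x ≤ x + y
  x≤x+y x 0≤y = ≤-respˡ-≈ (+-identityʳ x) (+-monoʳ-≤ x 0≤y)

  x-y+y≈x : ∀ x y → x - y + y ≈ x
  x-y+y≈x x y = trans (+-assoc x (- y) y) (trans (+-congˡ (-‿inverseˡ y)) (+-identityʳ x))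

  x+y-y≈x : ∀ x y → x + y - y ≈ x
  x+y-y≈x x y = trans (+-assoc x y (- y)) (trans (+-congˡ (-‿inverseʳ y)) (+-identityʳ x))

  x≤y+z⇒x-z≤y : ∀ {x y z} → x ≤ y + z → x - z ≤ y
  x≤y+z⇒x-z≤y {x} {y} {z} x≤y+z = ≤-respʳ-≈ (x+y-y≈x y z) (+-monoˡ-≤ (- z) x≤y+z)

  x+z≤y⇒x≤y-z : ∀ {x y z} → x + z ≤ y → x ≤ y - z
  x+z≤y⇒x≤y-z {x} {y} {z} x+z≤y = ≤-respˡ-≈ (x+y-y≈x x z) (+-monoˡ-≤ (- z) x+z≤y)

  +-cancelʳ-≤ : ∀ {x y z} → x + z ≤ y + z → x ≤ y
  +-cancelʳ-≤ {y = y} {z} x+z≤y+z = ≤-respʳ-≈ (x+y-y≈x y z) (x+z≤y⇒x≤y-z x+z≤y+z)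

  x≤y⇒0≤y-x : ∀ {x y} → x ≤ y → 0# ≤ y - x
  x≤y⇒0≤y-x {x} x≤y = x+z≤y⇒x≤y-z (≤-respˡ-≈ (sym (+-identityˡ x)) x≤y)

  x<y⇒0<y-x : ∀ {x y} → x < y → 0# < y - x
  x<y⇒0<y-x {x} {y} (x≤y , x≉y) = x≤y⇒0≤y-x x≤y , λ 0≈y-x →
    x≉y (trans (sym (+-identityˡ x)) (trans (+-congʳ 0≈y-x) (x-y+y≈x y x)))

  <-≤-trans : ∀ {x y z} → x < y → y ≤ z → x < z
  <-≤-trans (x≤y , x≉y) y≤z = ≤-trans x≤y y≤z , λ x≈z → x≉y (≤-antisym x≤y (≤-respʳ-≈ (sym x≈z) y≤z))

  ≤-<-trans : ∀ {x y z} → x ≤ y → y < z → x < z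
  ≤-<-trans x≤y (y≤z , y≉z) = ≤-trans x≤y y≤z , λ x≈z → y≉z (≤-antisym y≤z (≤-respˡ-≈ x≈z x≤y))

  >⇒≉ : ∀ {x} → 0# < x → ¬ (x ≈ 0#)
  >⇒≉ (_ , 0≉x) = 0≉x ∘ sym

  *-monoˡ-≤ : ∀ {x y z} → 0# ≤ x → y ≤ z → y * x ≤ z * x
  *-monoˡ-≤ {x} {y} {z} 0≤x y≤z = begin
    y * x                    ≈⟨ +-identityˡ (y * x) ⟨
    0# + y * x               ≤⟨ +-monoˡ-≤ (y * x) (*-nonNegative (x≤y⇒0≤y-x y≤z) 0≤x) ⟩
    (z - y) * x + y * x      ≈⟨ solve 3 (λ d y x → d :* x :+ y :* x := (d :+ y) :* x) refl (z - y) y x ⟩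
    (z - y + y) * x          ≈⟨ *-congʳ (x-y+y≈x z y) ⟩
    z * x                    ∎

  *-monoʳ-≤ : ∀ {x y z} → 0# ≤ x → y ≤ z → x * y ≤ x * z
  *-monoʳ-≤ {x} {y} {z} 0≤x y≤z = begin
    x * y  ≈⟨ *-comm x y ⟩
    y * x  ≤⟨ *-monoˡ-≤ 0≤x y≤z ⟩
    z * x  ≈⟨ *-comm z x ⟩
    x * z  ∎

  0≤x*x : ∀ x → 0# ≤ x * x
  0≤x*x x with total 0# x
  ... | inj₁ 0≤x = *-nonNegative 0≤x 0≤x
  ... | inj₂ x≤0 = begin
    0#           ≤⟨ *-nonNegative 0≤-x 0≤-x ⟩
    - x * - x    ≈⟨ -‿distribˡ-* x (- x) ⟨
    - (x * - x)  ≈⟨ -‿distribʳ-* x (- x) ⟩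
    x * - - x    ≈⟨ *-congˡ (-‿involutive x) ⟩
    x * x        ∎
    where
    0≤-x : 0# ≤ - x
    0≤-x = ≤-respʳ-≈ (+-identityˡ (- x)) (x≤y⇒0≤y-x x≤0)

  x/y*y≈x : ∀ x {y} → 0# < y → x / y * y ≈ x
  x/y*y≈x x {y} 0<y = begin-equality
    x * y ⁻¹ * y    ≈⟨ *-assoc x (y ⁻¹) y ⟩
    x * (y ⁻¹ * y)  ≈⟨ *-congˡ (*-comm (y ⁻¹) y) ⟩
    x * (y * y ⁻¹)  ≈⟨ *-congˡ (⁻¹-inverseʳ y (>⇒≉ 0<y)) ⟩
    x * 1#          ≈⟨ *-identityʳ x ⟩
    x               ∎

  x*y/y≈x : ∀ x {y} → 0# < y → x * y / y ≈ x
  x*y/y≈x x {y} 0<y = begin-equality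
    x * y * y ⁻¹    ≈⟨ *-assoc x y (y ⁻¹) ⟩
    x * (y * y ⁻¹)  ≈⟨ *-congˡ (⁻¹-inverseʳ y (>⇒≉ 0<y)) ⟩
    x * 1#          ≈⟨ *-identityʳ x ⟩
    x               ∎

  -- y⁻¹ is y times a square.
  ⁻¹-nonNegative : ∀ {y} → 0# < y → 0# ≤ y ⁻¹
  ⁻¹-nonNegative {y} 0<y@(0≤y , _) = begin
    0#                   ≤⟨ *-nonNegative (0≤x*x (y ⁻¹)) 0≤y ⟩
    y ⁻¹ / y * y         ≈⟨ x/y*y≈x (y ⁻¹) 0<y ⟩
    y ⁻¹                 ∎

  *-cancelʳ-≤ : ∀ {x y z} → 0# < z → x * z ≤ y * z → x ≤ y
  *-cancelʳ-≤ {x} {y} {z} 0<z xz≤yz = begin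
    x          ≈⟨ x*y/y≈x x 0<z ⟨
    x * z / z  ≤⟨ *-monoˡ-≤ (⁻¹-nonNegative 0<z) xz≤yz ⟩
    y * z / z  ≈⟨ x*y/y≈x y 0<z ⟩
    y          ∎

  -- If the product vanished, multiplying it by `y ⁻¹` would give `x ≈ 0#`.
  *-positive : ∀ {x y} → 0# < x → 0# < y → 0# < x * y
  *-positive {x} {y} (0≤x , 0≉x) 0<y@(0≤y , _) = *-nonNegative 0≤x 0≤y , λ 0≈xy →
    0≉x (trans (sym (zeroˡ (y ⁻¹))) (trans (*-congʳ 0≈xy) (x*y/y≈x x 0<y)))

  /-nonNegative : ∀ {x y} → 0# ≤ x → 0# < y → 0# ≤ x / y
  /-nonNegative 0≤x 0<y = *-nonNegative 0≤x (⁻¹-nonNegative 0<y)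

  x≤y*z⇒x/z≤y : ∀ {x y z} → 0# < z → x ≤ y * z → x / z ≤ y
  x≤y*z⇒x/z≤y {x} 0<z x≤yz = *-cancelʳ-≤ 0<z (≤-respˡ-≈ (sym (x/y*y≈x x 0<z)) x≤yz)

  /-monoʳ-≤ : ∀ {x y z} → 0# ≤ x → 0# < y → y ≤ z → x / z ≤ x / y
  /-monoʳ-≤ {x} {y} {z} 0≤x 0<y y≤z = x≤y*z⇒x/z≤y (<-≤-trans 0<y y≤z) (begin
    x          ≈⟨ x/y*y≈x x 0<y ⟨
    x / y * y  ≤⟨ *-monoʳ-≤ (/-nonNegative 0≤x 0<y) y≤z ⟩
    x / y * z  ∎)

  -- The two sides are in fact equal. Multiplying the right side by `a * y` gives back `x`, so the
  -- inverse of a product never has to be computed.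
  /-scale-≤ : ∀ {a} x {y} → 0# < a → 0# < y → x / (a * y) ≤ 1# / a * (x / y)
  /-scale-≤ {a} x {y} 0<a 0<y = x≤y*z⇒x/z≤y (*-positive 0<a 0<y) (≤-reflexive (begin-equality
    x                            ≈⟨ *-identityˡ x ⟨
    1# * x                       ≈⟨ *-cong (x/y*y≈x 1# 0<a) (x/y*y≈x x 0<y) ⟨
    1# / a * a * (x / y * y)     ≈⟨ solve 4 (λ p a q y → p :* a :* (q :* y) := p :* q :* (a :* y)) refl (1# / a) a (x / y) y ⟩
    1# / a * (x / y) * (a * y)   ∎))

  -- Quotients in the field extended by ∞.

  ≤⁺-trans : ∀ {x y z} → x ≤⁺ y → y ≤⁺ z → x ≤⁺ z
  ≤⁺-trans = AddSupremum.≤⁺-trans _≤_ ≤-trans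

  /⁺-positive : ∀ x {y} → 0# < y → x /⁺ y ≡ [ x / y ]
  /⁺-positive x {y} 0<y = cong (if_then [ x / y ] else ⊤⁺) (dec-true (0# <? y) 0<y)

  /⁺-nonPositive : ∀ x {y} → ¬ (0# < y) → x /⁺ y ≡ ⊤⁺
  /⁺-nonPositive x {y} 0≮y = cong (if_then [ x / y ] else ⊤⁺) (dec-false (0# <? y) 0≮y)

  -- Splitting on the sign of `y` alone is enough: if `y` is not positive, the right side is ∞, and
  -- if it is, then so is `z` and both quotients are finite.
  /⁺-monoʳ-≤ : ∀ {x y z} → 0# ≤ x → y ≤ z → x /⁺ z ≤⁺ x /⁺ y
  /⁺-monoʳ-≤ {x} {y} {z} 0≤x y≤z with 0# <? y
  ... | no 0≮y  = subst (x /⁺ z ≤⁺_) (≡-sym (/⁺-nonPositive x 0≮y)) (AddSupremum._≤⊤⁺ _)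
  ... | yes 0<y = subst₂ _≤⁺_ (≡-sym (/⁺-positive x (<-≤-trans 0<y y≤z))) (≡-sym (/⁺-positive x 0<y))
    AddSupremum.[ /-monoʳ-≤ 0≤x 0<y y≤z ]

  -- Pulls a positive factor of the denominator out in front of the quotient. When `y` is not
  -- positive the right side is ∞.
  /⁺-scale-≤ : ∀ {a} x y → 0# < a → x /⁺ (a * y) ≤⁺ (1# / a) *⁺ (x /⁺ y)
  /⁺-scale-≤ {a} x y 0<a with 0# <? y
  ... | no 0≮y  = subst (λ q → x /⁺ (a * y) ≤⁺ (1# / a) *⁺ q) (≡-sym (/⁺-nonPositive x 0≮y)) (AddSupremum._≤⊤⁺ _)
  ... | yes 0<y = subst₂ (λ p q → p ≤⁺ (1# / a) *⁺ q)
    (≡-sym (/⁺-positive x (*-positive 0<a 0<y))) (≡-sym (/⁺-positive x 0<y))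
    AddSupremum.[ /-scale-≤ x 0<a 0<y ]

  sum-nonNegative : ∀ {n} (t : Vector Carrier n) → (∀ i → 0# ≤ t i) → 0# ≤ sum t
  sum-nonNegative {zero}  t 0≤t = ≤-refl
  sum-nonNegative {suc n} t 0≤t = ≤-respˡ-≈ (+-identityˡ 0#)
    (+-mono-≤ (0≤t zero) (sum-nonNegative (tail t) (0≤t ∘ suc)))

-- Cuts, degrees and volumes.

module HypergraphProperties {c ℓ₁ ℓ₂} {F : OrderedField c ℓ₁ ℓ₂} (H : Hypergraph F) where
  open OrderedField F
  open Hypergraph H
  open OrderedFieldProperties F
  open Sum (CommutativeRing.+-commutativeMonoid commutativeRing)
    using (∑-distrib-+; sum-cong-≋; sum-replicate-zero)
  open PartialOrderReasoning poset
  open SemiringSolver commutativeSemiring using (solve; _:=_; _:+_; _:*_; con)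

  cut-nonNegative : ∀ S → 0# ≤ cut H S
  cut-nonNegative S = sum-nonNegative _ λ e → w-nonNegative e (edge e ∩ S) (p∩q⊆p (edge e) S)

  degree-nonNegative : ∀ v → 0# ≤ degree H v
  degree-nonNegative v = sum-nonNegative _ summand
    where
    summand : ∀ e → 0# ≤ (if does (v ∈? edge e) then w e ⁅ v ⁆ else 0#)
    summand e with v ∈? edge e
    -- Nonnegativity of `w e` is granted only on subsets of the edge, and the singleton is one
    -- because `v` lies in the edge.
    ... | yes v∈e = w-nonNegative e ⁅ v ⁆ λ x∈⁅v⁆ → subst (_∈ edge e) (≡-sym (x∈⁅y⁆⇒x≡y v x∈⁅v⁆)) v∈e
    ... | no _    = ≤-refl

  vol-nonNegative : ∀ S → 0# ≤ vol H S
  vol-nonNegative S = sum-nonNegative _ summand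
    where
    summand : ∀ v → 0# ≤ (if does (v ∈? S) then degree H v else 0#)
    summand v with v ∈? S
    ... | yes _ = degree-nonNegative v
    ... | no _  = ≤-refl

  vol-⊥ : vol H ⊥ ≈ 0#
  vol-⊥ = trans (sum-cong-≋ summand) (sum-replicate-zero ∣V∣)
    where
    summand : ∀ v → (if does (v ∈? ⊥) then degree H v else 0#) ≈ 0#
    summand v with v ∈? ⊥
    ... | yes v∈⊥ = contradiction v∈⊥ ∉⊥
    ... | no _    = refl

  -- Each node of `S` lies in exactly one of `R` and `∁ R`, so its degree is counted once on the
  -- right.
  vol-split : ∀ S R → vol H S ≈ vol H (S ∩ R) + vol H (S ∩ ∁ R)
  vol-split S R = trans (sum-cong-≋ λ v → summand S R v (degree H v))
    (∑-distrib-+ (λ v → restrict (S ∩ R) v (degree H v)) (λ v → restrict (S ∩ ∁ R) v (degree H v)))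
    where
    restrict : ∀ {n} → Subset n → Fin n → Carrier → Carrier
    restrict S v x = if does (v ∈? S) then x else 0#

    -- The degree is abstracted to an arbitrary value `x`, and the size to `n`, so that the
    -- recursion can pass to the tails of the subsets, where degrees have no meaning.
    summand : ∀ {n} (S R : Subset n) v x → restrict S v x ≈ restrict (S ∩ R) v x + restrict (S ∩ ∁ R) v x
    summand (inside  ∷ S) (inside  ∷ R) zero    x = sym (+-identityʳ x)
    summand (inside  ∷ S) (outside ∷ R) zero    x = sym (+-identityˡ x)
    summand (outside ∷ S) (_       ∷ R) zero    x = sym (+-identityˡ 0#)
    summand (_       ∷ S) (_       ∷ R) (suc v) x = summand S R v x

  -- The same split with the roles exchanged: here `S` divides `R`, and the intersections are
  -- written in the order that `Ω` uses.
  vol-split′ : ∀ S R → vol H R ≈ vol H (S ∩ R) + vol H (∁ S ∩ R)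
  vol-split′ S R = trans (vol-split R S)
    (+-cong (reflexive (cong (vol H) (∩-comm R S))) (reflexive (cong (vol H) (∩-comm R (∁ S)))))

  vol-⊤ : ∀ R → vol H ⊤ ≈ vol H R + vol H (∁ R)
  vol-⊤ R = trans (vol-split ⊤ R)
    (+-cong (reflexive (cong (vol H) (∩-identityˡ R))) (reflexive (cong (vol H) (∩-identityˡ (∁ R)))))

  vol-disjoint : ∀ {T R} → T ⊆ R → vol H (T ∩ ∁ R) ≈ 0#
  vol-disjoint {T} {R} T⊆R = trans (reflexive (cong (vol H) (Empty-unique empty))) vol-⊥
    where
    empty : Empty (T ∩ ∁ R)
    empty (v , v∈) with x∈p∩q⁻ T (∁ R) v∈
    ... | v∈T , v∈∁R = x∈∁p⇒x∉p v∈∁R (T⊆R v∈T)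

  -- Upper bounds on `Ω` when `ε` is at least `ε₀`.

  module LocalConductance
    (R : Subset ∣V∣) (0<volR : 0# < vol H R) (volR≤vol∁R : vol H R ≤ vol H (∁ R))
    (ε : Carrier) (ε₀≤ε : vol H R / vol H (∁ R) ≤ ε)
    where

    private
      r r̄ ε₀ μ : Carrier
      r  = vol H R
      r̄  = vol H (∁ R)
      ε₀ = r / r̄
      μ  = ε - ε₀

      -- Makes `ε₀` a genuine quotient, away from the unspecified inverse of zero.
      0<r̄ : 0# < r̄
      0<r̄ = <-≤-trans 0<volR volR≤vol∁R

      ε₀*r̄≈r : ε₀ * r̄ ≈ r
      ε₀*r̄≈r = x/y*y≈x r 0<r̄

      0≤ε₀ : 0# ≤ ε₀
      0≤ε₀ = /-nonNegative (vol-nonNegative R) 0<r̄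

      0≤ε : 0# ≤ ε
      0≤ε = ≤-trans 0≤ε₀ ε₀≤ε

      ε₀≤1 : ε₀ ≤ 1#
      ε₀≤1 = x≤y*z⇒x/z≤y 0<r̄ (≤-respʳ-≈ (sym (*-identityˡ r̄)) volR≤vol∁R)

      0<vol⊤ : 0# < vol H ⊤
      0<vol⊤ = <-≤-trans 0<volR (≤-respʳ-≈ (sym (vol-⊤ R)) (x≤x+y r (vol-nonNegative (∁ R))))

    0≤μ : 0# ≤ μ
    0≤μ = x≤y⇒0≤y-x ε₀≤ε

    Ω≤vol : ∀ S → Ω H R ε S ≤ vol H S
    Ω≤vol S = x≤y+z⇒x-z≤y (begin
      a               ≤⟨ x≤x+y a (vol-nonNegative (S ∩ ∁ R)) ⟩
      a + b           ≈⟨ vol-split S R ⟨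
      vol H S         ≤⟨ x≤x+y (vol H S) (*-nonNegative 0≤ε (vol-nonNegative (S ∩ ∁ R))) ⟩
      vol H S + ε * b ∎)
      where
      a b : Carrier
      a = vol H (S ∩ R)
      b = vol H (S ∩ ∁ R)

    -- `S` and `R` cut the node set into four cells, of volumes `a`, `b`, `c′` and `d`. Since
    -- `a + c′` is `r`, which is `ε₀ * (b + d)`, it is at most `d + ε * b`. Hence `a - ε * b` is at
    -- most `d`, and so at most the volume `c′ + d` of the complement.
    Ω≤vol-∁ : ∀ S → Ω H R ε S ≤ vol H (∁ S)
    Ω≤vol-∁ S = x≤y+z⇒x-z≤y (begin
      a                    ≤⟨ x≤x+y a 0≤c ⟩
      a + c′               ≈⟨ vol-split′ S R ⟨
      r                    ≈⟨ ε₀*r̄≈r ⟨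
      ε₀ * r̄               ≈⟨ *-congˡ (vol-split′ S (∁ R)) ⟩
      ε₀ * (b + d)         ≈⟨ solve 3 (λ e b d → e :* (b :+ d) := e :* d :+ e :* b) refl ε₀ b d ⟩
      -- The two cells outside `R` are treated differently: the coefficient of `d` is raised to 1,
      -- by `vol R ≤ vol (∁ R)`, and that of `b` to `ε`.
      ε₀ * d + ε₀ * b      ≤⟨ +-mono-≤ (*-monoˡ-≤ 0≤d ε₀≤1) (*-monoˡ-≤ 0≤b ε₀≤ε) ⟩
      1# * d + ε * b       ≈⟨ +-congʳ (*-identityˡ d) ⟩
      d + ε * b            ≤⟨ +-monoˡ-≤ (ε * b) (x≤x+y d 0≤c) ⟩
      d + c′ + ε * b       ≈⟨ +-congʳ (+-comm d c′) ⟩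
      c′ + d + ε * b       ≈⟨ +-congʳ (vol-split (∁ S) R) ⟨
      vol H (∁ S) + ε * b  ∎)
      where
      a b c′ d : Carrier
      a  = vol H (S ∩ R)
      b  = vol H (S ∩ ∁ R)
      c′ = vol H (∁ S ∩ R)
      d  = vol H (∁ S ∩ ∁ R)
      0≤b : 0# ≤ b
      0≤b = vol-nonNegative (S ∩ ∁ R)
      0≤c : 0# ≤ c′
      0≤c = vol-nonNegative (∁ S ∩ R)
      0≤d : 0# ≤ d
      0≤d = vol-nonNegative (∁ S ∩ ∁ R)

    -- `Ω` is below both volumes, hence below their minimum, which is the denominator of `cond`.
    -- Where `Ω` is not positive, the right side is ∞.
    cond≤HLC : ∀ S → cond H S ≤⁺ HLC H R ε S
    cond≤HLC S = /⁺-monoʳ-≤ (cut-nonNegative S) (⊓-glb (Ω≤vol S) (Ω≤vol-∁ S))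

    -- Lower bounds on `Ω` for sets that overlap `R`.

    vol≤Ω : ∀ T → T ⊆ R → vol H T ≤ Ω H R ε T
    vol≤Ω T T⊆R = x+z≤y⇒x≤y-z (≤-reflexive (begin-equality
      vol H T + ε * b  ≈⟨ +-cong (vol-split T R) (*-congˡ b≈0) ⟩
      a + b + ε * 0#   ≈⟨ +-cong (+-congˡ b≈0) (zeroʳ ε) ⟩
      a + 0# + 0#      ≈⟨ trans (+-identityʳ (a + 0#)) (+-identityʳ a) ⟩
      a                ∎))
      where
      a b : Carrier
      a = vol H (T ∩ R)
      b = vol H (T ∩ ∁ R)
      b≈0 : b ≈ 0#
      b≈0 = vol-disjoint T⊆R

    module _ (T : Subset ∣V∣) (0<volT : 0# < vol H T) (γ : Carrier)
      (R-overlap : r / vol H ⊤ + γ * (r̄ / vol H ⊤) ≤ vol H (T ∩ R) / vol H T)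
      where
      private
        a b t v : Carrier
        a = vol H (T ∩ R)
        b = vol H (T ∩ ∁ R)
        t = vol H T
        v = vol H ⊤

      -- Multiply the overlap hypothesis by `t * v`. Since `r` is `ε₀ * r̄` and `v` is `r + r̄`,
      -- both sides become multiples of `r̄`, which cancels.
      R-overlap-cleared : (ε₀ + γ) * t ≤ a * (ε₀ + 1#)
      R-overlap-cleared = *-cancelʳ-≤ 0<r̄ (begin
        (ε₀ + γ) * t * r̄                     ≈⟨ solve 4 (λ e g t r → (e :+ g) :* t :* r := (e :* r :+ g :* r) :* t) refl ε₀ γ t r̄ ⟩
        (ε₀ * r̄ + γ * r̄) * t                 ≈⟨ *-congʳ (+-cong (trans ε₀*r̄≈r (sym (x/y*y≈x r 0<vol⊤))) (*-congˡ (sym (x/y*y≈x r̄ 0<vol⊤)))) ⟩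
        (r / v * v + γ * (r̄ / v * v)) * t    ≈⟨ solve 5 (λ p q g v t → (p :* v :+ g :* (q :* v)) :* t := (p :+ g :* q) :* (t :* v)) refl (r / v) (r̄ / v) γ v t ⟩
        (r / v + γ * (r̄ / v)) * (t * v)      ≤⟨ *-monoˡ-≤ (*-nonNegative (vol-nonNegative T) (vol-nonNegative ⊤)) R-overlap ⟩
        a / t * (t * v)                      ≈⟨ *-assoc (a / t) t v ⟨
        a / t * t * v                        ≈⟨ *-cong (x/y*y≈x a 0<volT) (trans (vol-⊤ R) (+-congʳ (sym ε₀*r̄≈r))) ⟩
        a * (ε₀ * r̄ + r̄)                     ≈⟨ solve 3 (λ a e r → a :* (e :* r :+ r) := a :* (e :+ con 1) :* r) refl a ε₀ r̄ ⟩
        a * (ε₀ + 1#) * r̄                    ∎)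

      -- Leaving `δ` free serves both conclusions about such a `T`: `δ = γ - μ` in general, and
      -- `δ = γ` when `μ` vanishes.
      scaled-vol≤Ω : ∀ {δ} → δ + μ ≤ γ → δ * t ≤ Ω H R ε T
      scaled-vol≤Ω {δ} δ+μ≤γ = x+z≤y⇒x≤y-z (+-cancelʳ-≤ (begin
        -- The term `ε₀ * a`, added to both sides, is what the cleared overlap bound carries besides
        -- `a`. Adding `μ * a` as well completes `(μ + ε₀) * b` to a multiple of `t`, because `t` is
        -- `a + b`.
        δ * t + ε * b + ε₀ * a                  ≈⟨ +-congʳ (+-congˡ (*-congʳ (x-y+y≈x ε ε₀))) ⟨
        δ * t + (μ + ε₀) * b + ε₀ * a           ≤⟨ x≤x+y _ (*-nonNegative 0≤μ (vol-nonNegative (T ∩ R))) ⟩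
        δ * t + (μ + ε₀) * b + ε₀ * a + μ * a   ≈⟨ solve 6 (λ d t m e a b → d :* t :+ (m :+ e) :* b :+ e :* a :+ m :* a := d :* t :+ (m :+ e) :* (a :+ b)) refl δ t μ ε₀ a b ⟩
        δ * t + (μ + ε₀) * (a + b)              ≈⟨ +-congˡ (*-congˡ (vol-split T R)) ⟨
        δ * t + (μ + ε₀) * t                    ≈⟨ solve 4 (λ d m e t → d :* t :+ (m :+ e) :* t := (e :+ (d :+ m)) :* t) refl δ μ ε₀ t ⟩
        (ε₀ + (δ + μ)) * t                      ≤⟨ *-monoˡ-≤ (vol-nonNegative T) (+-monoʳ-≤ ε₀ δ+μ≤γ) ⟩
        (ε₀ + γ) * t                            ≤⟨ R-overlap-cleared ⟩
        a * (ε₀ + 1#)                           ≈⟨ solve 2 (λ a e → a :* (e :+ con 1) := a :+ e :* a) refl a ε₀ ⟩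
        a + ε₀ * a                              ∎))

    -- Conductance of a minimizer of `HLC`.

    module _ {S* : Subset ∣V∣} (minimal : IsMinimizerHLC H R ε S*) where

      cond-minimizer≤HLC : ∀ T → cond H S* ≤⁺ HLC H R ε T
      cond-minimizer≤HLC T = ≤⁺-trans (cond≤HLC S*) (minimal T)

      cond-minimizer≤cond : ∀ T → T ⊆ R → cond H S* ≤⁺ cond H T
      cond-minimizer≤cond T T⊆R = ≤⁺-trans (cond-minimizer≤HLC T)
        (/⁺-monoʳ-≤ (cut-nonNegative T) (≤-trans (x⊓y≤x _ _) (vol≤Ω T T⊆R)))

      -- The denominator of `cond H T` is at most `vol H T`, so `δ` times it is still at most `Ω`.
      -- The quotient by this smaller denominator then releases the factor `1# / δ`.
      cond-minimizer≤scaled-cond : ∀ T {δ} → 0# < δ → δ * vol H T ≤ Ω H R ε T →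
                                   cond H S* ≤⁺ (1# / δ) *⁺ cond H T
      cond-minimizer≤scaled-cond T 0<δ@(0≤δ , _) δt≤Ω = ≤⁺-trans (cond-minimizer≤HLC T)
        (≤⁺-trans (/⁺-monoʳ-≤ (cut-nonNegative T) (≤-trans (*-monoʳ-≤ 0≤δ (x⊓y≤x _ _)) δt≤Ω))
                  (/⁺-scale-≤ (cut H T) _ 0<δ))

theorem4 :
    ∀ {c ℓ₁ ℓ₂ : Level} (F : OrderedField c ℓ₁ ℓ₂) (H : Hypergraph F) →
    let open OrderedField F
        open Hypergraph H using (∣V∣)
    in
    (R : Subset ∣V∣) → 0# < vol H R → vol H R ≤ vol H (∁ R) →
    let ε₀ = vol H R / vol H (∁ R) in
    (ε : Carrier) → ε₀ ≤ ε → ε < ε₀ + 1# →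
    let μ = ε - ε₀ in
    (S* : Subset ∣V∣) → IsMinimizerHLC H R ε S* →
    ((T : Subset ∣V∣) → T ⊆ R → 0# < vol H T → cond H S* ≤⁺ cond H T)
    ×
    ((T : Subset ∣V∣) → 0# < vol H T → vol H T ≤ vol H (∁ T) →
     (γ : Carrier) → μ < γ → γ < 1# →
     vol H R / vol H ⊤ + γ * (vol H (∁ R) / vol H ⊤) ≤ vol H (T ∩ R) / vol H T →
     (cond H S* ≤⁺ (1# / (γ - μ)) *⁺ cond H T)
     ×
     (ε ≈ ε₀ → cond H S* ≤⁺ (1# / γ) *⁺ cond H T))
theorem4 F H R 0<volR volR≤vol∁R ε ε₀≤ε _ S* minimal =
  (λ T T⊆R _ → cond-minimizer≤cond minimal T T⊆R) ,
  λ T 0<volT _ γ μ<γ _ R-overlap →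
    -- Here `δ` is `γ - μ`, the largest value with `δ + μ ≤ γ`.
    cond-minimizer≤scaled-cond minimal T (x<y⇒0<y-x μ<γ)
      (scaled-vol≤Ω T 0<volT γ R-overlap (≤-reflexive (x-y+y≈x γ _))) ,
    -- Now `μ` is zero, so `δ = γ` is admissible; its positivity comes from `0# ≤ μ` and `μ < γ`.
    λ ε≈ε₀ → cond-minimizer≤scaled-cond minimal T (≤-<-trans 0≤μ μ<γ)
      (scaled-vol≤Ω T 0<volT γ R-overlap
        (≤-reflexive (trans (+-congˡ (trans (+-congʳ ε≈ε₀) (-‿inverseʳ _))) (+-identityʳ γ))))
  where
  open OrderedField F
  open OrderedFieldProperties F
  open HypergraphProperties H
  open LocalConductance R 0<volR volR≤vol∁R ε ε₀≤ε
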